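{- Let $A_n = A_n(h,T)$ be an apex tree, where $T$ is a tree. Then for every signature $\sigma : E(A_n) \to \{+1,-1\}$, $l(A_n,\sigma) = p^-(A_n,\sigma)$.
   Context: All graphs are finite, simple and undirected. A signed graph $\Sigma=(G,\sigma)$ is a graph $G$ with a signature $\sigma:E(G)\to\{+1,-1\}$. The sign of a cycle is the product of the signs of its edges; $\Sigma$ is balanced if all its cycles are positive. The frustration index $l(\Sigma)$ is the minimum number of edges whose deletion makes $\Sigma$ balanced. $p^-(\Sigma)$ is the maximum number of pairwise edge-disjoint negative cycles in $\Sigma$. Apex tree: $A_n(h,T)$ denotes a graph with a vertex $h$ of degree $n$ such that deleting $h$ leaves the tree $T$. Standing assumptions: all leaves of $T$ are neighbours of $h$; the graph is $2$-connected (the trivial case $A_1=K_2$ is allowed); and every vertex of degree $2$ in the graph is contained in a triangle. -}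

module Defs where

open import Data.Empty using (⊥-elim)
open import Data.Fin using (Fin; punchIn; _<_)
open import Data.Fin.Properties using (<-cmp) renaming (_≟_ to _≟ᶠ_)
open import Data.List using (List; []; _∷_; length; filter; allFin; map; foldr)
open import Data.List.Relation.Binary.Disjoint.Propositional using (Disjoint)
open import Data.List.Relation.Unary.All using (All)
open import Data.List.Relation.Unary.AllPairs using (AllPairs)
open import Data.List.Relation.Unary.Unique.Propositional using (Unique)
open import Data.Nat using (ℕ; suc; _≤_)
open import Data.Nat.Properties using (≤-antisym)
open import Data.Product using (Σ-syntax; ∃-syntax; ∃₂; _×_; _,_; proj₁; proj₂)
open import Data.Sign using (Sign; _*_)
open import Data.Sum using (_⊎_)
open import Function using (_∘_; _⇔_)
open import Level using (0ℓ)
open import Relation.Binary using (Rel; Decidable; DecidableEquality; Symmetric; Irreflexive; tri<; tri≈; tri>)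
open import Relation.Binary.Construct.Closure.ReflexiveTransitive using (Star; ε; _◅_)
open import Relation.Binary.PropositionalEquality using (_≡_; _≢_; refl; sym; subst)
open import Relation.Nullary using (¬_; yes; no)

------------------------------------------------------------------------
-- Finite simple graphs

record Graph (n : ℕ) : Set₁ where
  field
    Adj         : Rel (Fin n) 0ℓ
    adj?        : Decidable Adj
    symmetric   : Symmetric Adj
    irreflexive : Irreflexive _≡_ Adj

open Graph public

-- An undirected edge is stored with its smaller endpoint first.  The two
-- proofs are irrelevant, so edges with the same endpoints are equal even
-- if Adj has several proofs.

record Edge {n} (G : Graph n) : Set where
  constructor mkEdge
  field
    lo hi  : Fin n
    .lo<hi : lo < hi
    .adj   : Adj G lo hi

edge : ∀ {n} (G : Graph n) {u v} → Adj G u v → Edge G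
edge G {u} {v} e with <-cmp u v
... | tri< u<v _ _ = mkEdge u v u<v e
... | tri≈ _ u≡v _ = ⊥-elim (irreflexive G u≡v e)
... | tri> _ _ v<u = mkEdge v u v<u (symmetric G e)

edge-irrelevant : ∀ {n} (G : Graph n) {u v} (e e′ : Adj G u v) →
                  edge G e ≡ edge G e′
edge-irrelevant G {u} {v} e e′ with <-cmp u v
... | tri< _ _ _   = refl
... | tri≈ _ u≡v _ = ⊥-elim (irreflexive G u≡v e)
... | tri> _ _ _   = refl

edge-symmetric : ∀ {n} (G : Graph n) {u v} (e : Adj G u v) →
                 edge G (symmetric G e) ≡ edge G e
edge-symmetric G {u} {v} e with <-cmp u v | <-cmp v u
... | tri< _ _ _   | tri> _ _ _   = refl
... | tri> _ _ _   | tri< _ _ _   = refl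
... | tri≈ _ u≡v _ | _            = ⊥-elim (irreflexive G u≡v e)
... | _            | tri≈ _ v≡u _ = ⊥-elim (irreflexive G (sym v≡u) e)
... | tri< u<v _ _ | tri< _ _ u≮v = ⊥-elim (u≮v u<v)
... | tri> _ _ v<u | tri> v≮u _ _ = ⊥-elim (v≮u v<u)

_≟ᴱ_ : ∀ {n} {G : Graph n} → DecidableEquality (Edge G)
mkEdge a b _ _ ≟ᴱ mkEdge c d _ _ with a ≟ᶠ c | b ≟ᶠ d
... | yes refl | yes refl = yes refl
... | no a≢c   | _        = no λ { refl → a≢c refl }
... | yes _    | no b≢d   = no λ { refl → b≢d refl }

module _ {n} {G : Graph n} where
  open import Data.List.Membership.DecPropositional (_≟ᴱ_ {G = G}) public
    using (_∈_; _∉_; _∈?_)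

degree : ∀ {n} → Graph n → Fin n → ℕ
degree G v = length (filter (adj? G v) (allFin _))

-- Vertex deletion; punchIn v enumerates the vertices other than v.

_-_ : ∀ {n} → Graph (suc n) → Fin (suc n) → Graph n
G - v = record
  { Adj         = λ x y → Adj G (punchIn v x) (punchIn v y)
  ; adj?        = λ x y → adj? G (punchIn v x) (punchIn v y)
  ; symmetric   = symmetric G
  ; irreflexive = λ { refl → irreflexive G refl }
  }

-- Edge deletion

_∖_ : ∀ {n} (G : Graph n) → List (Edge G) → Graph n
G ∖ F = record
  { Adj         = λ u v → Σ[ e ∈ Adj G u v ] edge G e ∉ F
  ; adj?        = dec
  ; symmetric   = λ { (e , e∉F) →
                      symmetric G e , subst (_∉ F) (sym (edge-symmetric G e)) e∉F }
  ; irreflexive = λ u≡v → irreflexive G u≡v ∘ proj₁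
  }
  where
  dec : Decidable (λ u v → Σ[ e ∈ Adj G u v ] edge G e ∉ F)
  dec u v with adj? G u v
  ... | no ¬e = no (¬e ∘ proj₁)
  ... | yes e with edge G e ∈? F
  ...   | no  e∉F = yes (e , e∉F)
  ...   | yes e∈F = no λ { (e′ , e′∉F) →
                      e′∉F (subst (λ f → f ∈ F) (edge-irrelevant G e e′) e∈F) }

------------------------------------------------------------------------
-- Walks, cycles, connectivity

Walk : ∀ {n} (G : Graph n) → Rel (Fin n) 0ℓ
Walk G = Star (Adj G)

-- The final vertex is omitted, so a closed walk lists its base once.

vertices : ∀ {n} (G : Graph n) {u v} → Walk G u v → List (Fin n)
vertices G ε                 = []
vertices G (_◅_ {i = u} _ w) = u ∷ vertices G w

edges : ∀ {n} (G : Graph n) {u v} → Walk G u v → List (Edge G)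
edges G ε       = []
edges G (e ◅ w) = edge G e ∷ edges G w

-- A cycle comes with a base vertex and a direction; everything below
-- depends only on its edges.

record Cycle {n} (G : Graph n) : Set where
  field
    {base} : Fin n
    walk   : Walk G base base
    simple : Unique (vertices G walk)
    long   : 3 ≤ length (vertices G walk)

cycleEdges : ∀ {n} {G : Graph n} → Cycle G → List (Edge G)
cycleEdges {G = G} C = edges G (Cycle.walk C)

EdgeDisjoint : ∀ {n} {G : Graph n} → Rel (Cycle G) 0ℓ
EdgeDisjoint C D = Disjoint (cycleEdges C) (cycleEdges D)

Connected : ∀ {n} → Graph n → Set
Connected {n} G = Fin n × (∀ u v → Walk G u v)

IsTree : ∀ {n} → Graph n → Set
IsTree G = Connected G × ¬ Cycle G

TwoConnected : ∀ {n} → Graph (suc n) → Set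
TwoConnected {n} G = 3 ≤ suc n × Connected G × (∀ v → Connected (G - v))

IsK₂ : ∀ {n} → Graph n → Set
IsK₂ {n} G = n ≡ 2 × (∀ {u v} → u ≢ v → Adj G u v)

InTriangle : ∀ {n} → Graph n → Fin n → Set
InTriangle G v = ∃₂ λ u w → Adj G v u × Adj G u w × Adj G w v

------------------------------------------------------------------------
-- Signed graphs

Signature : ∀ {n} → Graph n → Set
Signature G = Edge G → Sign

restrict : ∀ {n} {G : Graph n} (F : List (Edge G)) → Signature G → Signature (G ∖ F)
restrict F σ (mkEdge u v u<v e) = σ (mkEdge u v u<v (proj₁ e))

sign : ∀ {n} {G : Graph n} → Signature G → Cycle G → Sign
sign σ C = foldr _*_ Sign.+ (map σ (cycleEdges C))

Balanced : ∀ {n} (G : Graph n) → Signature G → Set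
Balanced G σ = (C : Cycle G) → sign σ C ≡ Sign.+

IsMinimum : (ℕ → Set) → ℕ → Set
IsMinimum P k = P k × (∀ {m} → P m → k ≤ m)

IsMaximum : (ℕ → Set) → ℕ → Set
IsMaximum P k = P k × (∀ {m} → P m → m ≤ k)

IsFrustrationIndex : ∀ {n} (G : Graph n) → Signature G → ℕ → Set
IsFrustrationIndex G σ = IsMinimum λ k →
  ∃[ F ] Unique F × length F ≡ k × Balanced (G ∖ F) (restrict F σ)

IsNegativePackingNumber : ∀ {n} (G : Graph n) → Signature G → ℕ → Set
IsNegativePackingNumber G σ = IsMaximum λ k →
  Σ[ Cs ∈ List (Cycle G) ]
    length Cs ≡ k × All (λ C → sign σ C ≡ Sign.-) Cs × AllPairs EdgeDisjoint Cs

minimum-unique : ∀ {P k l} → IsMinimum P k → IsMinimum P l → k ≡ l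
minimum-unique (pk , k≤) (pl , l≤) = ≤-antisym (k≤ pl) (l≤ pk)

maximum-unique : ∀ {P k l} → IsMaximum P k → IsMaximum P l → k ≡ l
maximum-unique (pk , ≤k) (pl , ≤l) = ≤-antisym (≤l pk) (≤k pl)

------------------------------------------------------------------------
-- Apex trees

-- G is A_n(h,T).  K₂ (n = 1) is the only graph allowed that is not 2-connected.

record IsApexTree {m} (n : ℕ) (G : Graph (suc m)) (h : Fin (suc m)) (T : Graph m) : Set where
  field
    degree-h   : degree G h ≡ n
    deletion   : ∀ {u v} → Adj (G - h) u v ⇔ Adj T u v
    tree       : IsTree T
    leaves     : ∀ v → degree T v ≡ 1 → Adj G h (punchIn h v)
    connected  : TwoConnected G ⊎ IsK₂ G
    triangles  : ∀ v → degree G v ≡ 2 → InTriangle G v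

{-# OPTIONS --safe #-}

-- Root the tree G − h and process it from the leaves.  Each vertex collects walks to h: its own edge
-- to h, and at most one walk handed up by each child.  Two walks of opposite sign close up to a negative
-- closed walk, which contains a negative cycle; of the remaining walks, all of one sign, one is extended
-- to the parent.  The surviving signs also define a switching of G (unmatched vertices follow their
-- parent) whose violated edges are no more numerous than the matched pairs.  Deleting these edges
-- balances G, and no packing of negative cycles is larger than such a deletion set, so both are optimal.

module Submission where

open import Defs hiding (_∈_; _∉_; _∈?_)
open import Data.Bool using (if_then_else_)
open import Data.Empty using (⊥-elim)
open import Data.Fin using (Fin; punchIn; punchOut)
open import Data.Fin.Properties using (<-cmp; punchIn-injective; punchIn-punchOut; punchInᵢ≢i) renaming (_≟_ to _≟ᶠ_)
open import Data.List using (List; []; _∷_; _++_; allFin; concatMap; filter; foldr; length; map)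
open import Data.List.Membership.DecPropositional using (_∈?_)
open import Data.List.Membership.Propositional using (_∈_; _∉_; find)
open import Data.List.Membership.Propositional.Properties
  using (∈-++⁺ˡ; ∈-++⁺ʳ; ∈-++⁻; ∈-∃++; ∈-allFin; ∈-concatMap⁺; ∈-filter⁺; ∈-map⁻)
open import Data.List.Properties using (++-identityʳ; concatMap-++; length-++; length-map; map-++; map-cong; map-∘)
open import Data.List.Relation.Binary.Disjoint.Propositional using (Disjoint)
open import Data.List.Relation.Binary.Subset.Propositional using (_⊆_)
open import Data.List.Relation.Unary.All as All using (All; []; _∷_)
import Data.List.Relation.Unary.All.Properties as All
open import Data.List.Relation.Unary.AllPairs as AllPairs using (AllPairs; []; _∷_)
import Data.List.Relation.Unary.AllPairs.Properties as AllPairs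
open import Data.List.Relation.Unary.Any as Any using (Any; here; there)
import Data.List.Relation.Unary.Any.Properties as Any
open import Data.List.Relation.Unary.Unique.Propositional using (Unique)
import Data.List.Relation.Unary.Unique.Propositional.Properties as Unique
open import Data.Nat using (ℕ; suc; _+_; _≤_; z≤n; s≤s)
open import Data.Nat.ListAction using (sum)
open import Data.Nat.ListAction.Properties using (sum-++)
import Data.Nat.Properties as ℕ
open import Data.Nat.Tactic.RingSolver using (solve-∀)
open import Data.Product using (Σ-syntax; ∃-syntax; ∃₂; _×_; _,_; proj₁; proj₂)
open import Data.Sign using (Sign; _*_)
import Data.Sign.Properties as Sign
open import Data.Sum using (_⊎_; inj₁; inj₂; [_,_])
open import Data.Vec.Functional using (insertAt; updateAt)
open import Data.Vec.Functional.Properties using (insertAt-lookup; insertAt-punchIn; updateAt-minimal; updateAt-updates)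
open import Function using (_∘_)
open import Function.Bundles using (Equivalence)
open import Relation.Binary using (tri<; tri≈; tri>)
open import Relation.Binary.Construct.Closure.ReflexiveTransitive using (ε; _◅_; _◅◅_; gmap; revApp)
open import Relation.Binary.PropositionalEquality using (_≡_; _≢_; refl; sym; trans; cong; cong₂; subst)
open import Relation.Nullary using (¬_; ¬?; contradiction; does; no; yes)
open import Relation.Nullary.Decidable using (decidable-stable; dec-false; dec-true)

-- Walks and loop erasure

unique-++∷⁻ : ∀ {A : Set} (xs : List A) {y ys} → Unique (xs ++ y ∷ ys) → Unique (y ∷ xs) × Unique (y ∷ ys)
unique-++∷⁻ []       ys! = [] ∷ [] , ys!
unique-++∷⁻ (x ∷ xs) (x# ∷ xs!) with unique-++∷⁻ xs xs! | All.++⁻ xs x#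
... | y#xs ∷ xs!′ , ys! | x#xs , x≢y ∷ _ = ((x≢y ∘ sym) ∷ y#xs) ∷ x#xs ∷ xs!′ , ys!

edge-endpoints : ∀ {n} (G : Graph n) {u v x y} (e : Adj G u v) (f : Adj G x y) →
                 edge G e ≡ edge G f → (u ≡ x × v ≡ y) ⊎ (u ≡ y × v ≡ x)
edge-endpoints G {u} {v} {x} {y} e f eq with <-cmp u v | <-cmp x y
... | tri≈ _ u≡v _ | _            = ⊥-elim (irreflexive G u≡v e)
... | _            | tri≈ _ x≡y _ = ⊥-elim (irreflexive G x≡y f)
... | tri< _ _ _   | tri< _ _ _   = inj₁ (cong Edge.lo eq , cong Edge.hi eq)
... | tri< _ _ _   | tri> _ _ _   = inj₂ (cong Edge.lo eq , cong Edge.hi eq)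
... | tri> _ _ _   | tri< _ _ _   = inj₂ (cong Edge.hi eq , cong Edge.lo eq)
... | tri> _ _ _   | tri> _ _ _   = inj₁ (cong Edge.hi eq , cong Edge.lo eq)

module _ {n : ℕ} (G : Graph n) where

  targets support : ∀ {u v} → Walk G u v → List (Fin n)
  targets ε                 = []
  targets (_◅_ {j = v} _ w) = v ∷ targets w
  support {u} w = u ∷ targets w

  support-◅◅ : ∀ {u v x} (p : Walk G u v) (q : Walk G v x) →
               support (p ◅◅ q) ≡ vertices G p ++ support q
  support-◅◅ ε       q = refl
  support-◅◅ (e ◅ p) q = cong (_ ∷_) (support-◅◅ p q)

  edges-◅◅ : ∀ {u v x} (p : Walk G u v) (q : Walk G v x) →
             edges G (p ◅◅ q) ≡ edges G p ++ edges G q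
  edges-◅◅ ε       q = refl
  edges-◅◅ (e ◅ p) q = cong (_ ∷_) (edges-◅◅ p q)

  target∈support : ∀ {u v} (w : Walk G u v) → v ∈ support w
  target∈support ε       = here refl
  target∈support (_ ◅ w) = there (target∈support w)

  split : ∀ {u v x} (p : Walk G u v) → x ∈ support p →
          Σ[ q ∈ Walk G u x ] Σ[ r ∈ Walk G x v ] p ≡ q ◅◅ r
  split p       (here refl) = ε , p , refl
  split (e ◅ p) (there x∈) with split p x∈
  ... | q , r , refl = e ◅ q , r , refl

  module _ (σ : Signature G) where

    walkSign : ∀ {u v} → Walk G u v → Sign
    walkSign w = foldr _*_ Sign.+ (map σ (edges G w))

    walkSign-◅◅ : ∀ {u v x} (p : Walk G u v) (q : Walk G v x) →
                  walkSign (p ◅◅ q) ≡ walkSign p * walkSign q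
    walkSign-◅◅ ε       q = refl
    walkSign-◅◅ (e ◅ p) q = trans (cong (σ (edge G e) *_) (walkSign-◅◅ p q))
                                  (sym (Sign.*-assoc (σ (edge G e)) (walkSign p) (walkSign q)))

    -- An edge is stored without direction, so reversal only reorders the factors. For two walks
    -- with both ends in common this is the sign of the closed walk that they form.
    walkSign-revApp : ∀ {u v x} (p : Walk G u v) (q : Walk G u x) →
                      walkSign (revApp (symmetric G) p q) ≡ walkSign p * walkSign q
    walkSign-revApp ε       q = refl
    walkSign-revApp (e ◅ p) q
      rewrite walkSign-revApp p (symmetric G e ◅ q) | edge-symmetric G e
      = trans (sym (Sign.*-assoc (walkSign p) (σ (edge G e)) (walkSign q)))
              (cong (_* walkSign q) (Sign.*-comm (walkSign p) (σ (edge G e))))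

    NegativeCycleWithin : List (Edge G) → Set
    NegativeCycleWithin es = Σ[ C ∈ Cycle G ] sign σ C ≡ Sign.- × cycleEdges C ⊆ es

    -- Only lengths one and two keep a closed walk with distinct vertices from being a cycle. The
    -- first would be a loop; the second runs along one edge twice and is positive.
    simpleClosed⇒cycle : ∀ {u v} (e : Adj G u v) (p : Walk G v u) →
                         Unique (u ∷ vertices G p) → walkSign (e ◅ p) ≡ Sign.- →
                         NegativeCycleWithin (edges G (e ◅ p))
    simpleClosed⇒cycle e ε _ _ = ⊥-elim (irreflexive G refl e)
    simpleClosed⇒cycle e (f ◅ ε) _ neg
      rewrite trans (edge-irrelevant G f (symmetric G e)) (edge-symmetric G e)
            | Sign.*-identityʳ (σ (edge G e)) | Sign.s*s≡+ (σ (edge G e)) with () ← neg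
    simpleClosed⇒cycle e p@(_ ◅ _ ◅ _) unique neg =
      record { walk = e ◅ p ; simple = unique ; long = s≤s (s≤s (s≤s z≤n)) } , neg , λ z → z

    -- Erasing a positive loop leaves the sign unchanged, and a negative loop is itself a cycle.
    -- Edges are tracked as a set, which is enough to pass edge-disjointness from closed walks to
    -- cycles.
    loopErase : ∀ {u v} (w : Walk G u v) → NegativeCycleWithin (edges G w) ⊎
                (Σ[ p ∈ Walk G u v ] Unique (support p) × walkSign p ≡ walkSign w × edges G p ⊆ edges G w)
    loopErase ε = inj₂ (ε , [] ∷ [] , refl , λ z → z)
    loopErase {u} (e ◅ w) with loopErase w
    ... | inj₁ (C , neg , C⊆w) = inj₁ (C , neg , there ∘ C⊆w)
    ... | inj₂ (p , p! , p≡w , p⊆w) with _∈?_ _≟ᶠ_ u (support p)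
    ...   | no u∉p = inj₂ (e ◅ p , All.¬Any⇒All¬ _ u∉p ∷ p! , cong (σ (edge G e) *_) p≡w ,
                           λ { (here eq) → here eq ; (there f∈p) → there (p⊆w f∈p) })
    ...   | yes u∈p with split p u∈p
    -- `e ◅ q` is the loop that the new step closes at `u`; its vertices are distinct because the
    -- part already erased repeats none.
    ...     | q , r , refl with walkSign (e ◅ q) in eq
    ...       | Sign.- = inj₁ (let C , neg , C⊆eq = simpleClosed⇒cycle e q (proj₁ q!,r!) eq in C , neg , e◅q⊆e◅w ∘ C⊆eq)
      where
      q!,r! = unique-++∷⁻ (vertices G q) (subst Unique (support-◅◅ q r) p!)
      e◅q⊆e◅w : edges G (e ◅ q) ⊆ edges G (e ◅ w)
      e◅q⊆e◅w (here eq)   = here eq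
      e◅q⊆e◅w (there f∈q) = there (p⊆w (subst (_ ∈_) (sym (edges-◅◅ q r)) (∈-++⁺ˡ f∈q)))
    ...       | Sign.+ = inj₂ (r , proj₂ (unique-++∷⁻ (vertices G q) (subst Unique (support-◅◅ q r) p!)) ,
                               trans (cong (_* walkSign r) (sym eq))
                                 (trans (Sign.*-assoc (σ (edge G e)) (walkSign q) (walkSign r))
                                   (cong (σ (edge G e) *_) (trans (sym (walkSign-◅◅ q r)) p≡w))) ,
                               λ f∈r → there (p⊆w (subst (_ ∈_) (sym (edges-◅◅ q r)) (∈-++⁺ʳ (edges G q) f∈r))))

    -- A walk from `u` to `u` with distinct support is empty, hence positive, so loop erasure of a
    -- negative closed walk must meet a negative cycle.
    closedWalk⇒cycle : ∀ {u} (w : Walk G u u) → walkSign w ≡ Sign.- → NegativeCycleWithin (edges G w)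
    closedWalk⇒cycle w neg with loopErase w
    ... | inj₁ C                             = C
    ... | inj₂ (ε , _ , p≡w , _)             with () ← trans p≡w neg
    ... | inj₂ (_ ◅ p , u# ∷ _ , _ , _) = contradiction refl (All.lookup u# (target∈support p))

    walkSign-all-positive : ∀ {u v} (w : Walk G u v) → All (λ e → σ e ≡ Sign.+) (edges G w) → walkSign w ≡ Sign.+
    walkSign-all-positive ε       []       = refl
    walkSign-all-positive (e ◅ w) (p ∷ ps) rewrite p = walkSign-all-positive w ps

-- Leaf orderings of a tree

module _ {n : ℕ} (H : Graph n) where

  -- The head is a leaf hung on a vertex of the tail, so recursion strips leaves and ends at the
  -- root. An ordering alone only describes a spanning tree of the listed vertices; that an acyclic
  -- `H` has no further edges among them is `adjacent⇒linked`.
  data Ordering : List (Fin n) → Set where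
    root : ∀ r → Ordering (r ∷ [])
    leaf : ∀ {L u v} → v ∉ L → u ∈ L → Adj H v u → Ordering L → Ordering (v ∷ L)

  -- An adjacency with its ends, child first in `links`, because it is read both as an edge of `H`
  -- and, when `H` is `G - h`, as an edge of `G`.
  Link : Set
  Link = ∃₂ (Adj H)

  linkEdge : Link → Edge H
  linkEdge (_ , _ , e) = edge H e

  Joins : Fin n → Fin n → Link → Set
  Joins x y (u , v , _) = (x ≡ u × y ≡ v) ⊎ (x ≡ v × y ≡ u)

  links : ∀ {L} → Ordering L → List Link
  links (root r)       = []
  links (leaf _ _ e O) = (_ , _ , e) ∷ links O

  links-within : ∀ {L} (O : Ordering L) → All (λ (u , v , _) → u ∈ L × v ∈ L) (links O)
  links-within (root r)         = []
  links-within (leaf _ u∈L _ O) =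
    (here refl , there u∈L) ∷ All.map (λ (u∈ , v∈) → there u∈ , there v∈) (links-within O)

  rootOf : ∀ {L} → Ordering L → Fin n
  rootOf (root r)       = r
  rootOf (leaf _ _ _ O) = rootOf O

  toRoot : ∀ {L} (O : Ordering L) {x} → x ∈ L →
           Σ[ w ∈ Walk H x (rootOf O) ] edges H w ⊆ map linkEdge (links O)
  toRoot (root r)         (here refl) = ε , λ ()
  toRoot (leaf _ u∈L e O) (here refl) with toRoot O u∈L
  ... | w , w⊆ = e ◅ w , λ { (here eq) → here eq ; (there f∈w) → there (w⊆ f∈w) }
  toRoot (leaf _ _   _ O) (there x∈L) with toRoot O x∈L
  ... | w , w⊆ = w , there ∘ w⊆

  -- Two neighbours would close up, through the root, to a closed walk using the first link once;
  -- it is negative when only that link is, so it contains a cycle.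
  unique-parent : ¬ Cycle H → ∀ {L} → Ordering L → ∀ {v x y} → v ∉ L → x ∈ L → y ∈ L →
                  Adj H v x → Adj H v y → x ≡ y
  unique-parent acyclic {L} O {v} {x} {y} v∉L x∈L y∈L e f with x ≟ᶠ y
  ... | yes x≡y = x≡y
  ... | no  x≢y = contradiction (proj₁ (closedWalk⇒cycle H τ (revApp (symmetric H) (e ◅ p) (f ◅ q)) negative)) acyclic
    where
    τ : Signature H
    τ g = if does (edge H e ≟ᴱ g) then Sign.- else Sign.+
    τ-other : ∀ {g} → edge H e ≢ g → τ g ≡ Sign.+
    τ-other {g} e≢g rewrite dec-false (edge H e ≟ᴱ g) e≢g = refl
    p = proj₁ (toRoot O x∈L)
    q = proj₁ (toRoot O y∈L)
    positive : ∀ {z} {w : Walk H z (rootOf O)} → edges H w ⊆ map linkEdge (links O) → walkSign H τ w ≡ Sign.+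
    positive {w = w} w⊆ = walkSign-all-positive H τ w (All.tabulate λ g∈w → τ-other (avoids (w⊆ g∈w)))
      where
      avoids : ∀ {g} → g ∈ map linkEdge (links O) → edge H e ≢ g
      avoids g∈ e≡g with ∈-map⁻ linkEdge g∈
      ... | (_ , _ , k) , l∈ , g≡l with edge-endpoints H e k (trans e≡g g≡l) | All.lookup (links-within O) l∈
      ...   | inj₁ (refl , _) | v∈ , _ = v∉L v∈
      ...   | inj₂ (refl , _) | _ , v∈ = v∉L v∈
    negative : walkSign H τ (revApp (symmetric H) (e ◅ p) (f ◅ q)) ≡ Sign.-
    negative
      rewrite walkSign-revApp H τ (e ◅ p) (f ◅ q)
            | positive {w = p} (proj₂ (toRoot O x∈L)) | positive {w = q} (proj₂ (toRoot O y∈L))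
            | dec-true (edge H e ≟ᴱ edge H e) refl
            | τ-other {edge H f} (λ e≡f → [ x≢y ∘ proj₂ , (λ { (refl , _) → v∉L y∈L }) ] (edge-endpoints H e f e≡f))
      = refl

  -- Of two adjacent vertices, the one listed first becomes the head while the other is in the tail,
  -- and by `unique-parent` its only neighbour in the tail is its parent.
  adjacent⇒linked : ¬ Cycle H → ∀ {L} (O : Ordering L) {x y} → x ∈ L → y ∈ L → Adj H x y → Any (Joins x y) (links O)
  adjacent⇒linked acyclic (root r) (here refl) (here refl) e = ⊥-elim (irreflexive H refl e)
  adjacent⇒linked acyclic (leaf _ _ _ _) (here refl) (here refl) e = ⊥-elim (irreflexive H refl e)
  adjacent⇒linked acyclic (leaf v∉ u∈ f O) (here refl) (there y∈) e =
    here (inj₁ (refl , unique-parent acyclic O v∉ y∈ u∈ e f))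
  adjacent⇒linked acyclic (leaf v∉ u∈ f O) (there x∈) (here refl) e =
    here (inj₂ (unique-parent acyclic O v∉ x∈ u∈ (symmetric H e) f , refl))
  adjacent⇒linked acyclic (leaf v∉ u∈ f O) (there x∈) (there y∈) e = there (adjacent⇒linked acyclic O x∈ y∈ e)

  -- Along the walk, each vertex not yet listed becomes a leaf hung on its predecessor.
  extend : ∀ {L} → Ordering L → ∀ {x z} → x ∈ L → Walk H x z → ∃[ L′ ] Ordering L′ × L ⊆ L′ × z ∈ L′
  extend O x∈L ε = _ , O , (λ z → z) , x∈L
  extend {L} O x∈L (_◅_ {j = y} e w) with _∈?_ _≟ᶠ_ y L
  ... | yes y∈L = extend O y∈L w
  ... | no  y∉L with extend (leaf y∉L x∈L (symmetric H e) O) (here refl) w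
  ...   | L′ , O′ , ⊆L′ , z∈L′ = L′ , O′ , ⊆L′ ∘ there , z∈L′

  spanningOrdering : Connected H → ∃[ L ] Ordering L × (∀ x → x ∈ L)
  spanningOrdering (r , walk) with cover (allFin n)
    where
    cover : ∀ xs → ∃[ L ] Ordering L × r ∈ L × xs ⊆ L
    cover []       = r ∷ [] , root r , here refl , λ ()
    cover (x ∷ xs) with cover xs
    ... | L , O , r∈L , xs⊆L with extend O r∈L (walk r x)
    ...   | L′ , O′ , L⊆L′ , x∈L′ =
      L′ , O′ , L⊆L′ r∈L , λ { (here refl) → x∈L′ ; (there y∈xs) → L⊆L′ (xs⊆L y∈xs) }
  ... | L , O , _ , all⊆L = L , O , λ x → all⊆L (∈-allFin x)

-- Multiplicities and packings

mismatch : Sign → Sign → ℕ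
mismatch s t = if does (s Sign.≟ t) then 0 else 1

mismatch-self : ∀ s → mismatch s s ≡ 0
mismatch-self Sign.+ = refl
mismatch-self Sign.- = refl

-- A sign is its own inverse, so a factor may change sides. In `solve` this turns a violated link
-- into a walk that disagrees at the parent.
mismatch-* : ∀ r s t → mismatch (r * s) t ≡ mismatch r (s * t)
mismatch-* Sign.+ Sign.+ Sign.+ = refl
mismatch-* Sign.+ Sign.+ Sign.- = refl
mismatch-* Sign.+ Sign.- Sign.+ = refl
mismatch-* Sign.+ Sign.- Sign.- = refl
mismatch-* Sign.- Sign.+ Sign.+ = refl
mismatch-* Sign.- Sign.+ Sign.- = refl
mismatch-* Sign.- Sign.- Sign.+ = refl
mismatch-* Sign.- Sign.- Sign.- = refl

-- There are only two signs, so `t` equals one of `r`, `s` and differs from the other. Hence a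
-- matched pair of walks costs exactly one under every potential, which is charged to the closed
-- walk that the pair forms.
mismatch-≢ : ∀ {r s} → r ≢ s → ∀ t → mismatch r t + mismatch s t ≡ 1
mismatch-≢ {Sign.+} {Sign.+} r≢s t = ⊥-elim (r≢s refl)
mismatch-≢ {Sign.-} {Sign.-} r≢s t = ⊥-elim (r≢s refl)
mismatch-≢ {Sign.+} {Sign.-} _ Sign.+ = refl
mismatch-≢ {Sign.+} {Sign.-} _ Sign.- = refl
mismatch-≢ {Sign.-} {Sign.+} _ Sign.+ = refl
mismatch-≢ {Sign.-} {Sign.+} _ Sign.- = refl

≢⇒*≡- : ∀ {r s} → r ≢ s → r * s ≡ Sign.-
≢⇒*≡- {Sign.+} {Sign.+} r≢s = ⊥-elim (r≢s refl)
≢⇒*≡- {Sign.-} {Sign.-} r≢s = ⊥-elim (r≢s refl)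
≢⇒*≡- {Sign.+} {Sign.-} _ = refl
≢⇒*≡- {Sign.-} {Sign.+} _ = refl

module _ {n : ℕ} {G : Graph n} where

  occurs : Edge G → Edge G → ℕ
  occurs e f = if does (e ≟ᴱ f) then 1 else 0

  -- Multiplicities make edge-disjointness arithmetical: they add up under concatenation, and a
  -- total of at most one gives disjointness by `count≤1⇒disjoint`.
  count : Edge G → List (Edge G) → ℕ
  count e es = sum (map (occurs e) es)

  count-++ : ∀ e es fs → count e (es ++ fs) ≡ count e es + count e fs
  count-++ e es fs = trans (cong sum (map-++ (occurs e) es fs)) (sum-++ (map (occurs e) es) _)

  count-revApp : ∀ e {u v x} (p : Walk G u v) (q : Walk G u x) →
                 count e (edges G (revApp (symmetric G) p q)) ≡ count e (edges G p) + count e (edges G q)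
  count-revApp e ε       q = refl
  count-revApp e (f ◅ p) q
    rewrite count-revApp e p (symmetric G f ◅ q) | edge-symmetric G f
    = exchange (occurs e (edge G f)) (count e (edges G p)) (count e (edges G q))
    where
    exchange : ∀ a b c → b + (a + c) ≡ a + b + c
    exchange = solve-∀

unique-⊆⇒length≤ : ∀ {A : Set} {xs ys : List A} → Unique xs → xs ⊆ ys → length xs ≤ length ys
unique-⊆⇒length≤ [] _ = z≤n
unique-⊆⇒length≤ {xs = x ∷ xs} (x# ∷ xs!) xs⊆ys with ∈-∃++ (xs⊆ys (here refl))
... | ps , qs , refl = ℕ.≤-trans (s≤s (unique-⊆⇒length≤ xs! without)) (ℕ.≤-reflexive (sym (length-insert ps)))
  where
  length-insert : ∀ ps → length (ps ++ x ∷ qs) ≡ suc (length (ps ++ qs))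
  length-insert []       = refl
  length-insert (_ ∷ ps) = cong suc (length-insert ps)
  without : xs ⊆ ps ++ qs
  without y∈xs with ∈-++⁻ ps (xs⊆ys (there y∈xs))
  ... | inj₁ y∈ps         = ∈-++⁺ˡ y∈ps
  ... | inj₂ (here refl)  = contradiction refl (All.lookup x# y∈xs)
  ... | inj₂ (there y∈qs) = ∈-++⁺ʳ ps y∈qs

module _ {n : ℕ} {G : Graph n} where

  ∈⇒1≤count : ∀ {e} {es : List (Edge G)} → e ∈ es → 1 ≤ count e es
  ∈⇒1≤count {e} (here {xs = es} refl) rewrite dec-true (e ≟ᴱ e) refl = s≤s z≤n
  ∈⇒1≤count {e} (there {x = f} {xs = es} e∈) = ℕ.≤-trans (∈⇒1≤count e∈) (ℕ.m≤n+m (count e es) (occurs e f))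

  ∉⇒count≡0 : ∀ {e} {es : List (Edge G)} → All (e ≢_) es → count e es ≡ 0
  ∉⇒count≡0 []                                              = refl
  ∉⇒count≡0 {e} {f ∷ _} (e≢f ∷ e∉) rewrite dec-false (e ≟ᴱ f) e≢f = ∉⇒count≡0 e∉

  unique⇒count≤1 : ∀ e {es : List (Edge G)} → Unique es → count e es ≤ 1
  unique⇒count≤1 e []         = z≤n
  unique⇒count≤1 e {f ∷ es} (f# ∷ es!) with e ≟ᴱ f
  ... | yes refl = s≤s (ℕ.≤-reflexive (∉⇒count≡0 f#))
  ... | no  _    = unique⇒count≤1 e es!

  count≤1⇒disjoint : ∀ {A : Set} (f : A → List (Edge G)) xs → (∀ e → count e (concatMap f xs) ≤ 1) →
                     AllPairs (λ x y → Disjoint (f x) (f y)) xs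
  count≤1⇒disjoint f [] _ = []
  count≤1⇒disjoint f (x ∷ xs) ≤1 =
    All.tabulate (λ y∈xs {e} (e∈fx , e∈fy) → ℕ.<⇒≱ (s≤s (s≤s z≤n)) (ℕ.≤-trans
      (ℕ.+-mono-≤ (∈⇒1≤count e∈fx) (∈⇒1≤count (∈-concatMap⁺ f (Any.map (λ { refl → e∈fy }) y∈xs)))) (≤1′ e))) ∷
    count≤1⇒disjoint f xs λ e → ℕ.≤-trans (ℕ.m≤n+m _ (count e (f x))) (≤1′ e)
    where
    ≤1′ : ∀ e → count e (f x) + count e (concatMap f xs) ≤ 1
    ≤1′ e = subst (_≤ 1) (count-++ e (f x) (concatMap f xs)) (≤1 e)

-- Switchings, deletion sets and weak duality

same-endpoints : ∀ {n} (G G′ : Graph n) {u v} (e : Adj G u v) (e′ : Adj G′ u v) →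
                 Edge.lo (edge G e) ≡ Edge.lo (edge G′ e′) × Edge.hi (edge G e) ≡ Edge.hi (edge G′ e′)
same-endpoints G G′ {u} {v} e e′ with <-cmp u v
... | tri< _ _ _   = refl , refl
... | tri≈ _ u≡v _ = ⊥-elim (irreflexive G u≡v e)
... | tri> _ _ _   = refl , refl

edge-≡ : ∀ {n} {G : Graph n} {e f : Edge G} → Edge.lo e ≡ Edge.lo f × Edge.hi e ≡ Edge.hi f → e ≡ f
edge-≡ {e = mkEdge _ _ _ _} {mkEdge _ _ _ _} (refl , refl) = refl

module _ {n : ℕ} (G : Graph n) (σ : Signature G) where

  -- The switching by `s` of the all-positive signature; the edges where `σ` departs from it will
  -- form the deletion set.
  endpointSign : (Fin n → Sign) → Edge G → Sign
  endpointSign s e = s (Edge.lo e) * s (Edge.hi e)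

  endpointSign-edge : ∀ s {u v} (e : Adj G u v) → endpointSign s (edge G e) ≡ s u * s v
  endpointSign-edge s {u} {v} e with <-cmp u v
  ... | tri< _ _ _   = refl
  ... | tri≈ _ u≡v _ = ⊥-elim (irreflexive G u≡v e)
  ... | tri> _ _ _   = Sign.*-comm (s v) (s u)

  violated : (Fin n → Sign) → List (Edge G) → List (Edge G)
  violated s = filter (λ e → ¬? (σ e Sign.≟ endpointSign s e))

  length-violated : ∀ s es → length (violated s es) ≡ sum (map (λ e → mismatch (σ e) (endpointSign s e)) es)
  length-violated s [] = refl
  length-violated s (e ∷ es) with σ e Sign.≟ endpointSign s e
  ... | yes _ = length-violated s es
  ... | no  _ = cong suc (length-violated s es)

  restrict-edge : ∀ F {u v} (e : Adj (G ∖ F) u v) → restrict F σ (edge (G ∖ F) e) ≡ σ (edge G (proj₁ e))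
  restrict-edge F e = cong σ (edge-≡ (lo≡ , hi≡))
    where
    lo≡ = proj₁ (same-endpoints (G ∖ F) G e (proj₁ e))
    hi≡ = proj₂ (same-endpoints (G ∖ F) G e (proj₁ e))

  -- Every edge left has sign `s u * s v`, so the product along a walk telescopes to the signs of
  -- its two ends, which cancel when the walk is closed.
  violated-balances : ∀ s es → (∀ {u v} (e : Adj G u v) → edge G e ∈ es) →
                      Balanced (G ∖ violated s es) (restrict (violated s es) σ)
  violated-balances s es complete C = trans (telescope (Cycle.walk C)) (Sign.s*s≡+ (s (Cycle.base C)))
    where
    F = violated s es
    telescope : ∀ {u v} (w : Walk (G ∖ F) u v) → walkSign (G ∖ F) (restrict F σ) w ≡ s u * s v
    telescope {u} ε = sym (Sign.s*s≡+ (s u))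
    telescope {u} {v} (_◅_ {j = x} (e , e∉F) w)
      rewrite restrict-edge F (e , e∉F) | telescope w
            | decidable-stable (σ (edge G e) Sign.≟ endpointSign s (edge G e)) (e∉F ∘ ∈-filter⁺ _ (complete e))
            | endpointSign-edge s e
      = trans (Sign.*-assoc (s u) (s x) (s x * s v)) (cong (s u *_)
          (trans (sym (Sign.*-assoc (s x) (s x) (s v))) (cong (_* s v) (Sign.s*s≡+ (s x)))))

  avoid : ∀ F {u v} (w : Walk G u v) → All (_∉ F) (edges G w) →
          Σ[ w′ ∈ Walk (G ∖ F) u v ] vertices (G ∖ F) w′ ≡ vertices G w ×
            walkSign (G ∖ F) (restrict F σ) w′ ≡ walkSign G σ w
  avoid F ε       []         = ε , refl , refl
  avoid F (e ◅ w) (e∉F ∷ w#F) with avoid F w w#F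
  ... | w′ , vs , ss = (e , e∉F) ◅ w′ , cong (_ ∷_) vs , cong₂ _*_ (restrict-edge F (e , e∉F)) ss

  -- A cycle that misses `F` survives the deletion with its sign, so balance makes it positive.
  negative-meets : ∀ F → Balanced (G ∖ F) (restrict F σ) → ∀ C → sign σ C ≡ Sign.- →
                   ∃[ e ] e ∈ cycleEdges C × e ∈ F
  negative-meets F balanced C neg with Any.any? (λ e → _∈?_ _≟ᴱ_ e F) (cycleEdges C)
  ... | yes meets = let e , e∈C , e∈F = find meets in e , e∈C , e∈F
  ... | no  misses with avoid F (Cycle.walk C) (All.¬Any⇒All¬ _ misses)
  ...   | w , vs , ss with () ← trans (sym (balanced record
            { walk = w ; simple = subst Unique (sym vs) (Cycle.simple C)
            ; long = subst (λ l → 3 ≤ length l) (sym vs) (Cycle.long C) })) (trans ss neg)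

  -- Each negative cycle contains an edge of `F`, and disjointness makes the chosen edges distinct.
  packing≤deletion : ∀ F → Balanced (G ∖ F) (restrict F σ) → ∀ Cs → All (λ C → sign σ C ≡ Sign.-) Cs →
                     AllPairs EdgeDisjoint Cs → length Cs ≤ length F
  packing≤deletion F balanced Cs neg disjoint with pick Cs neg disjoint
    where
    pick : ∀ Cs → All (λ C → sign σ C ≡ Sign.-) Cs → AllPairs EdgeDisjoint Cs →
           ∃[ es ] length es ≡ length Cs × Unique es × es ⊆ F × All (λ e → Any (λ C → e ∈ cycleEdges C) Cs) es
    pick [] [] [] = [] , refl , [] , (λ ()) , []
    pick (C ∷ Cs) (n ∷ neg) (C# ∷ disjoint) with negative-meets F balanced C n | pick Cs neg disjoint
    ... | e , e∈C , e∈F | es , len , es! , es⊆F , es∈Cs =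
      e ∷ es , cong suc len ,
      -- This is why `pick` records where its edges lie: those chosen for `Cs` lie on cycles
      -- disjoint from `C`, so none of them equals `e`.
      All.map (λ { f∈Cs refl → All.lookupAny C# f∈Cs .proj₁ (e∈C , All.lookupAny C# f∈Cs .proj₂) }) es∈Cs ∷ es! ,
      (λ { (here refl) → e∈F ; (there f∈) → es⊆F f∈ }) ,
      here e∈C ∷ All.map there es∈Cs
  ... | es , len , es! , es⊆F , _ = subst (_≤ length F) len (unique-⊆⇒length≤ es! es⊆F)

  -- By `packing≤deletion`, `F` bounds every packing from above and `Cs` bounds every deletion set
  -- from below. With the reverse inequality between their sizes, each certifies the other as
  -- optimal.
  duality : ∀ F Cs → Unique F → Balanced (G ∖ F) (restrict F σ) → All (λ C → sign σ C ≡ Sign.-) Cs →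
            AllPairs EdgeDisjoint Cs → length F ≤ length Cs →
            ∃[ k ] IsFrustrationIndex G σ k × IsNegativePackingNumber G σ k
  duality F Cs F! balanced neg disjoint F≤Cs =
    length F ,
    ((F , F! , refl , balanced) ,
     λ { (F′ , _ , refl , balanced′) → ℕ.≤-trans F≤Cs (packing≤deletion F′ balanced′ Cs neg disjoint) }) ,
    ((Cs , ℕ.≤-antisym (packing≤deletion F balanced Cs neg disjoint) F≤Cs , neg , disjoint) ,
     λ { (Cs′ , refl , neg′ , disjoint′) → packing≤deletion F balanced Cs′ neg′ disjoint′ })

-- Graphs with an apex

module Apex {m : ℕ} (G : Graph (suc m)) (h : Fin (suc m)) where

  H : Graph m
  H = G - h

  ι : Fin m → Fin (suc m)
  ι = punchIn h

  -- Directed towards `h`, so that a spoke is already a one-edge walk to `h`.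
  Spoke : Set
  Spoke = ∃[ x ] Adj G (ι x) h

  spokeEdge : Spoke → Edge G
  spokeEdge (_ , e) = edge G e

  spokes : List (Fin m) → List Spoke
  spokes []       = []
  spokes (x ∷ xs) with adj? G (ι x) h
  ... | yes e = (x , e) ∷ spokes xs
  ... | no  _ = spokes xs

  spoke∈ : ∀ {x xs} → x ∈ xs → Adj G (ι x) h → Any (λ t → x ≡ proj₁ t) (spokes xs)
  spoke∈ {x} {y ∷ _} (here refl) e with adj? G (ι y) h
  ... | yes _ = here refl
  ... | no ¬e = contradiction e ¬e
  spoke∈ {x} {y ∷ _} (there x∈) e with adj? G (ι y) h
  ... | yes _ = there (spoke∈ x∈ e)
  ... | no  _ = spoke∈ x∈ e

  All-spokes : ∀ {P : Fin m → Set} {xs} → All P xs → All (P ∘ proj₁) (spokes xs)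
  All-spokes [] = []
  All-spokes {xs = x ∷ _} (px ∷ ps) with adj? G (ι x) h
  ... | yes _ = px ∷ All-spokes ps
  ... | no  _ = All-spokes ps

  unique-spokes : ∀ {xs} → Unique xs → Unique (map spokeEdge (spokes xs))
  unique-spokes [] = []
  unique-spokes {x ∷ _} (x# ∷ xs!) with adj? G (ι x) h
  ... | no  _ = unique-spokes xs!
  ... | yes e = All.map⁺ (All.map differ (All-spokes x#)) ∷ unique-spokes xs!
    where
    differ : ∀ {t : Spoke} → x ≢ proj₁ t → edge G e ≢ spokeEdge t
    differ {_ , f} x≢y eq with edge-endpoints G e f eq
    ... | inj₁ (ιx≡ιy , _) = x≢y (punchIn-injective h _ _ ιx≡ιy)
    ... | inj₂ (ιx≡h , _)  = punchInᵢ≢i h _ ιx≡h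

  rimEdge : Link H → Edge G
  rimEdge (_ , _ , e) = edge G e

  unique-rim : ∀ {L} (O : Ordering H L) → Unique (map rimEdge (links H O))
  unique-rim (root r)               = []
  unique-rim (leaf {u = u} {v} v∉L _ e O) = All.map⁺ (All.map differ (links-within H O)) ∷ unique-rim O
    where
    differ : ∀ {l : Link H} → proj₁ l ∈ _ × proj₁ (proj₂ l) ∈ _ → edge G e ≢ rimEdge l
    differ {_ , _ , f} (x∈L , y∈L) eq with edge-endpoints G e f eq
    ... | inj₁ (v≡x , _) = v∉L (subst (_∈ _) (sym (punchIn-injective h _ _ v≡x)) x∈L)
    ... | inj₂ (v≡y , _) = v∉L (subst (_∈ _) (sym (punchIn-injective h _ _ v≡y)) y∈L)

  apexEdges : ∀ {L} → Ordering H L → List (Edge G)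
  apexEdges O = map spokeEdge (spokes (allFin m)) ++ map rimEdge (links H O)

  unique-apexEdges : ∀ {L} (O : Ordering H L) → Unique (apexEdges O)
  unique-apexEdges O = Unique.++⁺ (unique-spokes (Unique.allFin⁺ m)) (unique-rim O) λ (e∈s , e∈r) → disjoint e∈s e∈r
    where
    disjoint : ∀ {e} → e ∈ map spokeEdge (spokes (allFin m)) → e ∉ map rimEdge (links H O)
    disjoint e∈s e∈r with ∈-map⁻ spokeEdge e∈s | ∈-map⁻ rimEdge e∈r
    ... | (_ , a) , _ , refl | (_ , _ , b) , _ , eq with edge-endpoints G a b eq
    ...   | inj₁ (_ , h≡y) = punchInᵢ≢i h _ (sym h≡y)
    ...   | inj₂ (_ , h≡x) = punchInᵢ≢i h _ (sym h≡x)

  spokeEdge∈ : ∀ {x} (e : Adj G (ι x) h) → edge G e ∈ map spokeEdge (spokes (allFin m))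
  spokeEdge∈ e = Any.map⁺ (Any.map (λ { {_ , f} refl → edge-irrelevant G e f }) (spoke∈ (∈-allFin _) e))

  view : ∀ x → x ≡ h ⊎ (∃[ y ] x ≡ ι y)
  view x with h ≟ᶠ x
  ... | yes h≡x = inj₁ (sym h≡x)
  ... | no  h≢x = inj₂ (punchOut h≢x , sym (punchIn-punchOut h≢x))

  apexEdges-complete : ¬ Cycle H → ∀ {L} (O : Ordering H L) → (∀ x → x ∈ L) →
                       ∀ {u v} (e : Adj G u v) → edge G e ∈ apexEdges O
  apexEdges-complete acyclic {L} O covers {u} {v} e with view u | view v
  ... | inj₁ refl | inj₁ refl = ⊥-elim (irreflexive G refl e)
  ... | inj₂ (x , refl) | inj₁ refl = ∈-++⁺ˡ (spokeEdge∈ e)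
  ... | inj₁ refl | inj₂ (x , refl) =
    ∈-++⁺ˡ (subst (_∈ _) (edge-symmetric G e) (spokeEdge∈ (symmetric G e)))
  ... | inj₂ (x , refl) | inj₂ (y , refl) =
    ∈-++⁺ʳ _ (∈-map⁺′ (adjacent⇒linked H acyclic O (covers x) (covers y) e))
    where
    joined : ∀ {l} → Joins H x y l → edge G e ≡ rimEdge l
    joined {_ , _ , f} (inj₁ (refl , refl)) = edge-irrelevant G e f
    joined {_ , _ , f} (inj₂ (refl , refl)) = trans (edge-irrelevant G e (symmetric G f)) (edge-symmetric G f)
    ∈-map⁺′ : ∀ {ls} → Any (Joins H x y) ls → edge G e ∈ map rimEdge ls
    ∈-map⁺′ = Any.map⁺ ∘ Any.map joined

-- Greedy matching

module Greedy {m : ℕ} (G : Graph (suc m)) (h : Fin (suc m)) (σ : Signature G) where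

  open Apex G h

  Token : Set
  Token = Σ[ x ∈ Fin m ] Walk G (ι x) h

  -- Closed walks suffice during the matching; they are cut down to cycles only in `apex-duality`.
  NegativeClosedWalk : Set
  NegativeClosedWalk = Σ[ x ∈ Fin (suc m) ] Σ[ w ∈ Walk G x x ] walkSign G σ w ≡ Sign.-

  tokenEdges : List Token → List (Edge G)
  tokenEdges = concatMap (λ (_ , w) → edges G w)

  closedEdges : List NegativeClosedWalk → List (Edge G)
  closedEdges = concatMap (λ (_ , w , _) → edges G w)

  -- The walk is treated as a single edge from `x` to `h`, with `h` at sign `+`, and costs one when
  -- `s` violates it.
  cost : (Fin m → Sign) → Token → ℕ
  cost s (x , w) = mismatch (walkSign G σ w) (s x)

  linkCost : (Fin m → Sign) → Link H → ℕ
  linkCost s (u , v , e) = mismatch (σ (edge G e)) (s u * s v)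

  -- Boyer-Moore voting: tokens at `v` of opposite signs cancel in pairs, those left share one sign,
  -- and tokens elsewhere pass through. A cancelled pair costs one under every `s`, so `cost≡` holds
  -- before the potential is chosen.
  record Gathered (v : Fin m) (L : List (Fin m)) (ts : List Token) : Set where
    field
      majority : Sign
      kept     : List (Walk G (ι v) h)
      uniform  : All (λ w → walkSign G σ w ≡ majority) kept
      rest     : List Token
      rest∈L   : All (λ t → proj₁ t ∈ L) rest
      matched  : List NegativeClosedWalk

    keptTokens : List Token
    keptTokens = map (v ,_) kept

    field
      cost≡  : ∀ s → sum (map (cost s) ts) ≡
                     length matched + (sum (map (cost s) keptTokens) + sum (map (cost s) rest))
      count≡ : ∀ e → count e (tokenEdges ts) ≡
                     count e (closedEdges matched) + (count e (tokenEdges keptTokens) + count e (tokenEdges rest))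

  private
    skip : ∀ a {b} c k r → b ≡ c + (k + r) → a + b ≡ c + (k + (a + r))
    skip a c k r refl = lemma a c k r
      where
      lemma : ∀ a c k r → a + (c + (k + r)) ≡ c + (k + (a + r))
      lemma = solve-∀

    keep : ∀ a {b} c k r → b ≡ c + (k + r) → a + b ≡ c + ((a + k) + r)
    keep a c k r refl = lemma a c k r
      where
      lemma : ∀ a c k r → a + (c + (k + r)) ≡ c + ((a + k) + r)
      lemma = solve-∀

    match : ∀ a {b} c d k r → b ≡ c + ((d + k) + r) → a + b ≡ ((a + d) + c) + (k + r)
    match a c d k r refl = lemma a c d k r
      where
      lemma : ∀ a c d k r → a + (c + ((d + k) + r)) ≡ ((a + d) + c) + (k + r)
      lemma = solve-∀

  module _ {v : Fin m} {L : List (Fin m)} {ts : List Token} {w : Walk G (ι v) h} where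

    keepHere : (g : Gathered v L ts) → ∀ {δ} → All (λ u → walkSign G σ u ≡ δ) (w ∷ Gathered.kept g) →
               Gathered v L ((v , w) ∷ ts)
    keepHere g {δ} uniform′ = record
      { Gathered g using (rest; rest∈L; matched)
      ; majority = δ
      ; kept     = w ∷ kept
      ; uniform  = uniform′
      ; cost≡    = λ s → keep (cost s (v , w)) (length matched) (sum (map (cost s) keptTokens)) _ (cost≡ s)
      ; count≡   = λ e → trans (count-++ e (edges G w) _) (trans
          (keep (count e (edges G w)) (count e (closedEdges matched)) (count e (tokenEdges keptTokens)) _ (count≡ e))
          (cong (λ z → count e (closedEdges matched) + (z + count e (tokenEdges rest)))
                (sym (count-++ e (edges G w) _)))) }
      where open Gathered g

    gatherHere : Gathered v L ts → Gathered v L ((v , w) ∷ ts)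
    gatherHere g with walkSign G σ w Sign.≟ Gathered.majority g
    gatherHere g                     | yes w≡δ = keepHere g (w≡δ ∷ Gathered.uniform g)
    -- With nothing kept, `majority` may be left over from cancelled walks, so the sign of `w`
    -- replaces it.
    gatherHere g@record { kept = [] } | no _   = keepHere g (refl ∷ [])
    gatherHere g@record { kept = u ∷ ws ; uniform = u≡δ ∷ ws≡δ } | no w≢δ = record
      { Gathered g using (majority; rest; rest∈L)
      ; kept    = ws
      ; uniform = ws≡δ
      -- Both walks run from `ι v` to `h`, so `w` reversed and followed by `u` is closed at `h`.
      ; matched = (h , revApp (symmetric G) w u , trans (walkSign-revApp G σ w u) (≢⇒*≡- w≢u)) ∷ matched
      ; cost≡   = λ s → trans
          (match (cost s (v , w)) (length matched) (cost s (v , u)) (sum (map (cost s) (map (v ,_) ws))) _ (cost≡ s))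
          (cong (λ z → z + length matched + (sum (map (cost s) (map (v ,_) ws)) + sum (map (cost s) rest))) (mismatch-≢ w≢u (s v)))
      ; count≡  = λ e → trans (count-++ e (edges G w) _) (trans
          (match (count e (edges G w)) (count e (closedEdges matched)) (count e (edges G u))
                 (count e (tokenEdges (map (v ,_) ws))) _
            (trans (count≡ e) (cong (λ z → count e (closedEdges matched) + (z + count e (tokenEdges rest)))
                                    (count-++ e (edges G u) _))))
          (cong (_+ (count e (tokenEdges (map (v ,_) ws)) + count e (tokenEdges rest)))
            (sym (trans (count-++ e (edges G (revApp (symmetric G) w u)) _)
                        (cong (_+ count e (closedEdges matched)) (count-revApp e w u)))))) }
      where
      open Gathered g
      w≢u : walkSign G σ w ≢ walkSign G σ u
      w≢u w≡u = w≢δ (trans w≡u u≡δ)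

  gather : ∀ v {L} ts → All (λ t → proj₁ t ∈ v ∷ L) ts → Gathered v L ts
  gather v [] [] = record
    { majority = Sign.+ ; kept = [] ; uniform = [] ; rest = [] ; rest∈L = [] ; matched = []
    ; cost≡ = λ _ → refl ; count≡ = λ _ → refl }
  gather v (t@(x , w) ∷ ts) (there x∈L ∷ ts∈) = record
    { Gathered g using (majority; kept; uniform; matched)
    ; rest   = t ∷ rest
    ; rest∈L = x∈L ∷ rest∈L
    ; cost≡  = λ s → skip (cost s t) (length matched) (sum (map (cost s) keptTokens)) _ (cost≡ s)
    ; count≡ = λ e → trans (count-++ e (edges G w) _) (trans
        (skip (count e (edges G w)) (count e (closedEdges matched)) (count e (tokenEdges keptTokens)) _ (count≡ e))
        (cong (λ z → count e (closedEdges matched) + (count e (tokenEdges keptTokens) + z))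
              (sym (count-++ e (edges G w) _)))) }
    where
    g = gather v ts ts∈
    open Gathered g
  gather v (_ ∷ ts) (here refl ∷ ts∈) = gatherHere (gather v ts ts∈)

  -- A dual pair: `cost≤` bounds the violations by the packing, and `count≤` lets the packing use
  -- each edge no more often than the tokens and links supply it. Tokens are arbitrary walks so that
  -- removing a leaf gives an instance of the same form.
  record Solution (ts : List Token) (ls : List (Link H)) : Set where
    field
      potential : Fin m → Sign
      packing   : List NegativeClosedWalk
      cost≤     : sum (map (cost potential) ts) + sum (map (linkCost potential) ls) ≤ length packing
      count≤    : ∀ e → count e (closedEdges packing) ≤ count e (tokenEdges ts) + count e (map rimEdge ls)

  cost-cong : ∀ {s s′ L} → (∀ {x} → x ∈ L → s x ≡ s′ x) → ∀ {ts} → All (λ t → proj₁ t ∈ L) ts →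
              sum (map (cost s) ts) ≡ sum (map (cost s′) ts)
  cost-cong s≡ []                 = refl
  cost-cong s≡ (_∷_ {_ , w} x∈ ts∈) =
    cong₂ _+_ (cong (mismatch (walkSign G σ w)) (s≡ x∈)) (cost-cong s≡ ts∈)

  linkCost-cong : ∀ {s s′ L} → (∀ {x} → x ∈ L → s x ≡ s′ x) → ∀ {ls : List (Link H)} →
                  All (λ (u , v , _) → u ∈ L × v ∈ L) ls →
                  sum (map (linkCost s) ls) ≡ sum (map (linkCost s′) ls)
  linkCost-cong s≡ []                 = refl
  linkCost-cong s≡ (_∷_ {_ , _ , e} (u∈ , v∈) ls∈) =
    cong₂ _+_ (cong₂ (λ a b → mismatch (σ (edge G e)) (a * b)) (s≡ u∈) (s≡ v∈)) (linkCost-cong s≡ ls∈)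

  kept-cost : ∀ {v ts L} (g : Gathered v L ts) s → (s v ≡ Gathered.majority g) →
              sum (map (cost s) (Gathered.keptTokens g)) ≡ 0
  kept-cost {v} g s sv≡δ = go uniform
    where
    open Gathered g
    go : ∀ {ws} → All (λ w → walkSign G σ w ≡ majority) ws → sum (map (cost s) (map (v ,_) ws)) ≡ 0
    go []         = refl
    go (w≡δ ∷ ps) rewrite w≡δ | sv≡δ | mismatch-self majority = go ps

  -- Shared by leaves that hand up no walk and leaves that hand up one: `new` is what is handed up,
  -- `x` the sign of `v`. The kept walks cost nothing under `x`, and the link to the parent is paid
  -- for by the cost of `new`, already accounted for in `S`.
  solve-leaf : ∀ {L u v} (v∉L : v ∉ L) (u∈L : u ∈ L) (a : Adj H v u) (O : Ordering H L) {ts} (g : Gathered v L ts)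
               (new : List Token) (S : Solution (new ++ Gathered.rest g) (links H O)) (x : Sign) →
               (∀ s → s v ≡ x → sum (map (cost s) (Gathered.keptTokens g)) ≡ 0) →
               mismatch (σ (edge G a)) (x * Solution.potential S u) ≤ sum (map (cost (Solution.potential S)) new) →
               (∀ e → count e (tokenEdges new) ≤ occurs e (edge G a) + count e (tokenEdges (Gathered.keptTokens g))) →
               Solution ts (links H (leaf v∉L u∈L a O))
  solve-leaf {L} {u} {v} v∉L u∈L a O {ts} g new S x kept≡0 link≤new count-new = record
    { potential = s′
    ; packing   = matched ++ packing
    ; cost≤     = begin
        sum (map (cost s′) ts) + (linkCost s′ (v , u , a) + sum (map (linkCost s′) (links H O)))
          ≡⟨ cong₂ (λ p q → p + (linkCost s′ (v , u , a) + q)) ts-cost (linkCost-cong agree (links-within H O)) ⟩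
        length matched + R + (linkCost s′ (v , u , a) + Ls)
          ≡⟨ cong (λ z → length matched + R + (z + Ls))
                  (cong₂ (λ p q → mismatch (σ (edge G a)) (p * q)) s′v≡x (agree u∈L)) ⟩
        length matched + R + (mismatch (σ (edge G a)) (x * s u) + Ls)
          ≤⟨ ℕ.+-monoʳ-≤ (length matched + R) (ℕ.+-monoˡ-≤ Ls link≤new) ⟩
        length matched + R + (sum (map (cost s) new) + Ls)
          ≡⟨ rearrange (length matched) R (sum (map (cost s) new)) Ls ⟩
        length matched + (sum (map (cost s) new) + R + Ls)
          ≡⟨ cong (λ z → length matched + (z + Ls))
                  (trans (sym (sum-++ (map (cost s) new) _)) (cong sum (sym (map-++ (cost s) new rest)))) ⟩
        length matched + (sum (map (cost s) (new ++ rest)) + Ls)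
          ≤⟨ ℕ.+-monoʳ-≤ (length matched) cost≤ ⟩
        length matched + length packing
          ≡⟨ length-++ matched ⟨
        length (matched ++ packing) ∎
    ; count≤    = λ e → begin
        count e (closedEdges (matched ++ packing))
          ≡⟨ trans (cong (count e) (concatMap-++ _ matched packing)) (count-++ e (closedEdges matched) _) ⟩
        count e (closedEdges matched) + count e (closedEdges packing)
          ≤⟨ ℕ.+-monoʳ-≤ (count e (closedEdges matched)) (count≤ e) ⟩
        count e (closedEdges matched) + (count e (tokenEdges (new ++ rest)) + count e (map rimEdge (links H O)))
          ≡⟨ cong (λ z → count e (closedEdges matched) + (z + count e (map rimEdge (links H O))))
                  (trans (cong (count e) (concatMap-++ _ new rest)) (count-++ e (tokenEdges new) _)) ⟩
        count e (closedEdges matched) +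
          (count e (tokenEdges new) + count e (tokenEdges rest) + count e (map rimEdge (links H O)))
          ≤⟨ ℕ.+-monoʳ-≤ (count e (closedEdges matched)) (ℕ.+-monoˡ-≤ (count e (map rimEdge (links H O)))
               (ℕ.+-monoˡ-≤ (count e (tokenEdges rest)) (count-new e))) ⟩
        count e (closedEdges matched) + (occurs e (edge G a) + count e (tokenEdges keptTokens)
          + count e (tokenEdges rest) + count e (map rimEdge (links H O)))
          ≡⟨ rearrange′ (count e (closedEdges matched)) (occurs e (edge G a)) _ _ _ ⟩
        count e (closedEdges matched) + (count e (tokenEdges keptTokens) + count e (tokenEdges rest))
          + (occurs e (edge G a) + count e (map rimEdge (links H O)))
          ≡⟨ cong (_+ _) (count≡ e) ⟨
        count e (tokenEdges ts) + (occurs e (edge G a) + count e (map rimEdge (links H O))) ∎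
    }
    where
    open Gathered g
    open Solution S renaming (potential to s)
    open ℕ.≤-Reasoning
    s′ : Fin m → Sign
    -- The remaining tokens and links lie within `L`, which omits `v`, so their costs do not change.
    s′ = updateAt s v (λ _ → x)
    s′v≡x : s′ v ≡ x
    s′v≡x = updateAt-updates v s
    agree : ∀ {y} → y ∈ L → s′ y ≡ s y
    agree {y} y∈L = updateAt-minimal y v s λ { refl → v∉L y∈L }
    R  = sum (map (cost s) rest)
    Ls = sum (map (linkCost s) (links H O))
    ts-cost : sum (map (cost s′) ts) ≡ length matched + R
    ts-cost = trans (cost≡ s′) (cong (length matched +_) (cong₂ _+_ (kept≡0 s′ s′v≡x) (cost-cong agree rest∈L)))
    rearrange : ∀ a b c d → a + b + (c + d) ≡ a + (c + b + d)
    rearrange = solve-∀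
    rearrange′ : ∀ c o k r l → c + (o + k + r + l) ≡ c + (k + r) + (o + l)
    rearrange′ = solve-∀

  solve : ∀ {L} (O : Ordering H L) ts → All (λ t → proj₁ t ∈ L) ts → Solution ts (links H O)
  solve (root r) ts ts∈ with gather r ts ts∈
  ... | g@record { rest = [] } = record
    -- No link remains and every token is at the root, whose majority sign agrees with all kept
    -- walks; the cost is one per matched pair.
    { potential = λ _ → majority
    ; packing   = matched
    ; cost≤     = ℕ.≤-reflexive (trans (ℕ.+-identityʳ _) (trans (cost≡ _)
                    (trans (cong (λ z → length matched + (z + 0)) (kept-cost g _ refl)) (ℕ.+-identityʳ _))))
    ; count≤    = λ e → ℕ.≤-trans (ℕ.m≤m+n _ _) (ℕ.≤-trans (ℕ.≤-reflexive (sym (count≡ e))) (ℕ.m≤m+n _ 0))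
    } where open Gathered g
  ... | record { rest = _ ∷ _ ; rest∈L = () ∷ _ }
  solve (leaf {u = u} {v} v∉L u∈L a O) ts ts∈ with gather v ts ts∈
  ... | g@record { kept = [] } =
    -- No kept walk constrains `v`, so its sign is chosen to satisfy the link to `u`.
    solve-leaf v∉L u∈L a O g [] S (σ (edge G a) * potential u) (λ _ _ → refl)
      (ℕ.≤-reflexive (trans (cong (mismatch (σ (edge G a))) cancel) (mismatch-self (σ (edge G a)))))
      (λ _ → z≤n)
    where
    open Gathered g
    S = solve O rest rest∈L
    open Solution S
    cancel : σ (edge G a) * potential u * potential u ≡ σ (edge G a)
    cancel = trans (Sign.*-assoc (σ (edge G a)) _ _)
      (trans (cong (σ (edge G a) *_) (Sign.s*s≡+ (potential u))) (Sign.*-identityʳ _))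
  ... | g@record { kept = w ∷ ws ; uniform = w≡δ ∷ _ } =
    -- `v` takes the common sign of its kept walks. Only one of them is extended, since the edge to
    -- the parent may be used once; by `mismatch-*` the extended walk disagrees at `u` exactly when
    -- the link is violated.
    solve-leaf v∉L u∈L a O g ((u , a′ ◅ w) ∷ []) S majority (kept-cost g)
      (ℕ.≤-reflexive (trans (sym (mismatch-* (σ (edge G a)) majority (potential u)))
        (trans (cong₂ (λ e δ → mismatch (σ e * δ) (potential u)) (sym (edge-symmetric G a)) (sym w≡δ))
               (sym (ℕ.+-identityʳ _)))))
      λ e → ℕ.+-mono-≤ (ℕ.≤-reflexive (cong (occurs e) (edge-symmetric G a)))
        (ℕ.≤-trans (ℕ.≤-reflexive (cong (count e) (++-identityʳ (edges G w))))
          (ℕ.≤-trans (ℕ.m≤m+n _ _) (ℕ.≤-reflexive (sym (count-++ e (edges G w) _)))))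
    where
    open Gathered g
    a′ = symmetric G a
    S = solve O ((u , a′ ◅ w) ∷ rest) (u∈L ∷ rest∈L)
    open Solution S

-- Optimality for an apex over a tree

module _ {m : ℕ} (G : Graph (suc m)) (h : Fin (suc m)) where

  open Apex G h

  apex-duality : Connected H → ¬ Cycle H → (σ : Signature G) →
                 ∃[ k ] IsFrustrationIndex G σ k × IsNegativePackingNumber G σ k
  apex-duality connected acyclic σ with spanningOrdering H connected
  ... | L , O , covers = duality G σ F Cs
          (Unique.filter⁺ _ (unique-apexEdges O))
          (violated-balances G σ s (apexEdges O) (apexEdges-complete acyclic O covers))
          (All.map⁺ (All.universal (λ c → proj₁ (proj₂ (toCycle c))) packing))
          (AllPairs.map⁺ (AllPairs.map (λ {c} {d} disj {_} (e∈c , e∈d) →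
             disj (proj₂ (proj₂ (toCycle c)) e∈c , proj₂ (proj₂ (toCycle d)) e∈d))
             (count≤1⇒disjoint (λ (_ , w , _) → edges G w) packing packing-count)))
          F≤Cs
    where
    open Greedy G h σ

    initial : List Token
    initial = map (λ (x , e) → x , e ◅ ε) (spokes (allFin m))

    open Solution (solve O initial (All.universal (λ t → covers (proj₁ t)) initial))

    s : Fin (suc m) → Sign
    -- With `+` at `h`, the violation of a spoke is the cost of its one-edge token.
    s = insertAt potential h Sign.+

    F : List (Edge G)
    F = violated G σ s (apexEdges O)

    toCycle : (c : NegativeClosedWalk) → NegativeCycleWithin G σ (edges G (proj₁ (proj₂ c)))
    toCycle (_ , w , neg) = closedWalk⇒cycle G σ w neg

    Cs : List (Cycle G)
    Cs = map (λ c → proj₁ (toCycle c)) packing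

    initial-edges : ∀ ts → tokenEdges (map (λ (x , e) → x , e ◅ ε) ts) ≡ map spokeEdge ts
    initial-edges []       = refl
    initial-edges (t ∷ ts) = cong (spokeEdge t ∷_) (initial-edges ts)

    packing-count : ∀ e → count e (closedEdges packing) ≤ 1
    packing-count e = begin
      count e (closedEdges packing)
        ≤⟨ count≤ e ⟩
      count e (tokenEdges initial) + count e (map rimEdge (links H O))
        ≡⟨ cong (λ es → count e es + count e (map rimEdge (links H O))) (initial-edges (spokes (allFin m))) ⟩
      count e (map spokeEdge (spokes (allFin m))) + count e (map rimEdge (links H O))
        ≡⟨ count-++ e (map spokeEdge (spokes (allFin m))) _ ⟨
      count e (apexEdges O)
        -- The initial tokens are the spokes, so tokens and links together list no edge twice.
        ≤⟨ unique⇒count≤1 e (unique-apexEdges O) ⟩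
      1 ∎
      where open ℕ.≤-Reasoning

    penalty : Edge G → ℕ
    penalty e = mismatch (σ e) (endpointSign G σ s e)

    spoke-penalty : ∀ t → penalty (spokeEdge t) ≡ cost potential (proj₁ t , proj₂ t ◅ ε)
    spoke-penalty (x , e) = cong₂ mismatch (sym (Sign.*-identityʳ (σ (edge G e))))
      (trans (endpointSign-edge G σ s e)
        (trans (cong₂ _*_ (insertAt-punchIn potential h Sign.+ x) (insertAt-lookup potential h Sign.+))
               (Sign.*-identityʳ (potential x))))

    rim-penalty : ∀ l → penalty (rimEdge l) ≡ linkCost potential l
    rim-penalty (x , y , e) = cong (mismatch (σ (edge G e)))
      (trans (endpointSign-edge G σ s e)
        (cong₂ _*_ (insertAt-punchIn potential h Sign.+ x) (insertAt-punchIn potential h Sign.+ y)))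

    F≤Cs : length F ≤ length Cs
    F≤Cs = begin
      length F
        ≡⟨ length-violated G σ s (apexEdges O) ⟩
      sum (map penalty (apexEdges O))
        ≡⟨ trans (cong sum (map-++ penalty (map spokeEdge (spokes (allFin m))) _))
                 (sum-++ (map penalty (map spokeEdge (spokes (allFin m)))) _) ⟩
      sum (map penalty (map spokeEdge (spokes (allFin m)))) + sum (map penalty (map rimEdge (links H O)))
        ≡⟨ cong₂ (λ xs ys → sum xs + sum ys)
             (trans (sym (map-∘ (spokes (allFin m))))
               (trans (map-cong spoke-penalty (spokes (allFin m))) (map-∘ (spokes (allFin m)))))
             (trans (sym (map-∘ (links H O))) (map-cong rim-penalty (links H O))) ⟩
      sum (map (cost potential) initial) + sum (map (linkCost potential) (links H O))
        ≤⟨ cost≤ ⟩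
      length packing
        ≡⟨ length-map _ packing ⟨
      length Cs ∎
      where open ℕ.≤-Reasoning

-- The adjacencies of `G - h` and `T` are equivalent, not equal, so a cycle of `G - h` must be
-- carried over to contradict the acyclicity of `T`.
mapCycle : ∀ {n} {G H : Graph n} → (∀ {u v} → Adj G u v → Adj H u v) → Cycle G → Cycle H
mapCycle {G = G} {H} f C = record
  { walk   = gmap (λ x → x) f walk
  ; simple = subst Unique (sym (vertices-map walk)) simple
  ; long   = subst (λ l → 3 ≤ length l) (sym (vertices-map walk)) long
  }
  where
  open Cycle C
  vertices-map : ∀ {u v} (w : Walk G u v) → vertices H (gmap (λ x → x) f w) ≡ vertices G w
  vertices-map ε       = refl
  vertices-map (_ ◅ w) = cong (_ ∷_) (vertices-map w)

theorem8 : ∀ {m} (n : ℕ) (G : Graph (suc m)) (h : Fin (suc m)) (T : Graph m) →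
    IsApexTree n G h T →
    (σ : Signature G) →
    ∃[ k ] (IsFrustrationIndex G σ k × IsNegativePackingNumber G σ k)
theorem8 n G h T apexTree = apex-duality G h
  (proj₁ (proj₁ tree) , λ u v → gmap (λ x → x) (Equivalence.from deletion) (proj₂ (proj₁ tree) u v))
  (proj₂ tree ∘ mapCycle (Equivalence.to deletion))
  where open IsApexTree apexTree
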